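{- For all integers $D\geq 2$ and $\beta\geq 1$, the maximum order of a connected graph with diameter $D$ and metric dimension $\beta$ is $$\left(\left\lfloor\frac{2D}{3}\right\rfloor+1\right)^\beta+\beta\sum_{i=1}^{\lceil D/3\rceil}(2i-1)^{\beta-1}.$$
   Context: Graphs are finite, undirected and simple; the order of a graph is its number of vertices. A vertex $x$ of a connected graph $G$ resolves a pair of vertices $v,w$ if $\mathrm{dist}(v,x)\neq\mathrm{dist}(w,x)$. A set $S\subseteq V(G)$ is a resolving set of $G$ if every pair of distinct vertices of $G$ is resolved by some vertex in $S$. The metric dimension of $G$ is the minimum cardinality of a resolving set of $G$. -}

module Defs where

open import Data.Fin using (Fin)
import Data.Fin.Properties as Fin
open import Data.Fin.Subset using (Subset; _∈_; ∣_∣)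
open import Data.List using (applyUpTo)
open import Data.Nat using (ℕ; zero; suc; _+_; _≤_; _/_; pred; NonZero; z≤n; s≤s)
open import Data.Nat.ListAction using (sum)
open import Data.Product using (∃; ∃-syntax; ∃₂; _×_; _,_; proj₁)
open import Function using (_∘_)
open import Level using (Level; 0ℓ)
import Relation.Nullary.Decidable as Dec
open import Relation.Nullary.Decidable using (yes; no; _×-dec_)
open import Relation.Nullary.Negation using (contradiction)
open import Relation.Binary.Core using (Rel)
import Relation.Binary.Definitions as Binary
open import Relation.Binary.PropositionalEquality using (_≡_; _≢_; refl)
open import Relation.Unary using (Pred; Decidable)

private variable
  ℓ : Level

IsLeast : Pred ℕ ℓ → ℕ → Set ℓ
IsLeast P m = P m × (∀ k → P k → m ≤ k)

IsGreatest : Pred ℕ ℓ → ℕ → Set ℓ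
IsGreatest P m = P m × (∀ k → P k → k ≤ m)

least : {P : Pred ℕ ℓ} → Decidable P → ∀ k → P k → ∃ (IsLeast P)
least P? zero p₀ = zero , p₀ , λ _ _ → z≤n
least P? (suc k) p with P? zero
... | yes p₀ = zero , p₀ , λ _ _ → z≤n
... | no ¬p₀ with least (P? ∘ suc) k p
...   | m , pm , min = suc m , pm , λ
        { zero p₀ → contradiction p₀ ¬p₀
        ; (suc j) pj → s≤s (min j pj)
        }

-- A finite simple graph of order n.  Decidability of adjacency is automatic
-- classically and is part of what a finite graph means constructively.
record Graph (n : ℕ) : Set₁ where
  field
    Adj    : Rel (Fin n) 0ℓ
    adj?   : Binary.Decidable Adj
    sym    : Binary.Symmetric Adj
    irrefl : Binary.Irreflexive _≡_ Adj

module _ {n : ℕ} (G : Graph n) where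
  open Graph G

  -- Walk u v k: a walk of length k from u to v.
  data Walk : Fin n → Fin n → ℕ → Set where
    []  : ∀ {v} → Walk v v zero
    _∷_ : ∀ {u v w k} → Adj u v → Walk v w k → Walk u w (suc k)

  Connected : Set
  Connected = ∀ u v → ∃ (Walk u v)

  walk? : ∀ u v → Decidable (Walk u v)
  walk? u v zero = Dec.map′ (λ { refl → [] }) (λ { [] → refl }) (u Fin.≟ v)
  walk? u v (suc k) =
    Dec.map′ (λ (_ , a , w) → a ∷ w) (λ { (a ∷ w) → _ , a , w })
      (Fin.any? λ x → adj? u x ×-dec walk? x v k)

module _ {n : ℕ} {G : Graph n} (conn : Connected G) where

  distance : ∀ u v → ∃ (IsLeast (Walk G u v))
  distance u v = let k , w = conn u v in least (walk? G u v) k w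

  -- The value does not depend on conn, since least elements are unique.
  dist : Fin n → Fin n → ℕ
  dist u v = proj₁ (distance u v)

  HasDiameter : ℕ → Set
  HasDiameter = IsGreatest λ d → ∃₂ λ u v → dist u v ≡ d

  Resolves : Fin n → Fin n → Fin n → Set
  Resolves x v w = dist v x ≢ dist w x

  IsResolvingSet : Subset n → Set
  IsResolvingSet S = ∀ v w → v ≢ w → ∃[ x ] x ∈ S × Resolves x v w

  HasMetricDimension : ℕ → Set
  HasMetricDimension = IsLeast λ k → ∃[ S ] IsResolvingSet S × ∣ S ∣ ≡ k

⌈_/_⌉ : (m d : ℕ) .{{_ : NonZero d}} → ℕ
⌈ m / d ⌉ = (m + pred d) / d

∑₁ : ℕ → (ℕ → ℕ) → ℕ
∑₁ n f = sum (applyUpTo (f ∘ suc) n)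

syntax ∑₁ n (λ i → e) = ∑[1≤ i ≤ n ] e

{-# OPTIONS --safe #-}

-- Upper bound: let A = ⌈D/3⌉ and c = ⌊2D/3⌋, so that A + c = D, and send each vertex to
-- its vector of distances to a resolving set of size k.  At most (c + 1)^k vectors have
-- all coordinates at least A.  Two vertices at distance h from the same landmark are at
-- distance at most 2h, so those vectors whose i-th coordinate is h < A lie in a box of
-- side 2h + 1.
--
-- Extremal graph: with B = ⌈D/3⌉ + ⌊D/3⌋, take the vectors x in [0, D]^β such that
-- x_j ≤ x_i + B and B ≤ x_i + x_j for all i ≠ j, adjacent when at Chebyshev distance 1.
-- This set is closed under moving every coordinate one step towards another admissible
-- vector, so graph distance is Chebyshev distance; hence the distance from x to the
-- vector (B, …, B, 0, B, …, B) is x_i, and these β vectors resolve the graph.  The upper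
-- bound increases strictly with k, so no smaller set does.

module Submission where

open import Defs
open import Data.Fin using (Fin; zero; suc; toℕ; combine; fromℕ<; finToFun; funToFin; punchIn; punchOut)
import Data.Fin.Properties as Fin
open import Data.Fin.Subset using (Subset; inside; outside; _∈_; ∣_∣; ⁅_⁆; _∪_) renaming (⊥ to ∅)
open import Data.Fin.Subset.Properties using (∣⊥∣≡0; ∣⁅x⁆∣≡1; x∈⁅x⁆; x∈p∪q⁺)
open import Data.List using (applyUpTo)
open import Data.Nat using (ℕ; zero; suc; _+_; _*_; _∸_; _^_; _≤_; _<_; _/_; _%_; _≟_; _≤?_; z≤n; s≤s; s≤s⁻¹)
open import Data.Nat.Properties
open import Data.Nat.DivMod using (+-distrib-/-∣ʳ; m*n/n≡m; m≡m%n+[m/n]*n; m%n<n)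
open import Data.Nat.Divisibility using (n∣m*n)
open import Data.Nat.ListAction using (sum)
open import Data.Nat.Tactic.RingSolver using (solve-∀)
open import Data.Product using (Σ-syntax; ∃-syntax; _×_; _,_; proj₁; proj₂; swap)
open import Data.Product.Function.NonDependent.Propositional using (_×-↔_)
open import Data.Sum using (_⊎_; inj₁; inj₂)
open import Data.Sum.Function.Propositional using (_⊎-↔_)
open import Data.Vec.Base using ([]; _∷_; there)
open import Data.Vec.Functional using (Vector; insertAt)
open import Data.Vec.Functional.Properties using (insertAt-lookup; insertAt-punchIn)
open import Function using (_∘_; _↔_; Inverse; mk↔ₛ′)
open import Function.Construct.Composition using (_↔-∘_)
open import Function.Properties.Inverse using (↔-refl)
open import Relation.Binary.Definitions using (tri<; tri≈; tri>)
open import Relation.Binary.PropositionalEquality using (_≡_; _≢_; _≗_; refl; sym; trans; cong; cong₂; subst; subst₂)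
open import Relation.Nullary using (Dec; yes; no; contradiction)
open import Relation.Nullary.Decidable using (_×-dec_; ¬?)

-- Counting by bijections between finite types

Fin-sum↔ : ∀ n (f : ℕ → ℕ) → Fin (sum (applyUpTo f n)) ↔ (Σ[ i ∈ Fin n ] Fin (f (toℕ i)))
Fin-sum↔ zero    f = mk↔ₛ′ (λ ()) (λ ()) (λ ()) (λ ())
Fin-sum↔ (suc n) f = mk↔ₛ′ to from to∘from from∘to ↔-∘ ((↔-refl ⊎-↔ Fin-sum↔ n (f ∘ suc)) ↔-∘ Fin.+↔⊎)
  where
  Tail = Σ[ i ∈ Fin n ] Fin (f (suc (toℕ i)))
  to : Fin (f 0) ⊎ Tail → Σ[ i ∈ Fin (suc n) ] Fin (f (toℕ i))
  to (inj₁ x)       = zero , x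
  to (inj₂ (i , x)) = suc i , x
  from : (Σ[ i ∈ Fin (suc n) ] Fin (f (toℕ i))) → Fin (f 0) ⊎ Tail
  from (zero  , x) = inj₁ x
  from (suc i , x) = inj₂ (i , x)
  to∘from : ∀ y → to (from y) ≡ y
  to∘from (zero  , _) = refl
  to∘from (suc _ , _) = refl
  from∘to : ∀ y → from (to y) ≡ y
  from∘to (inj₁ _) = refl
  from∘to (inj₂ _) = refl

finToFun-injective : ∀ {m n} {s t : Fin (m ^ n)} → finToFun {m} {n} s ≗ finToFun t → s ≡ t
finToFun-injective {m} {n} {s} {t} eq =
  trans (sym (Fin.funToFin-finToFin {n} {m} s)) (trans (funToFin-cong {n} {m} eq) (Fin.funToFin-finToFin {n} {m} t))
  where
  funToFin-cong : ∀ {m n} {f g : Fin m → Fin n} → f ≗ g → funToFin f ≡ funToFin g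
  funToFin-cong {zero}  f≗g = refl
  funToFin-cong {suc m} f≗g = cong₂ combine (f≗g zero) (funToFin-cong (f≗g ∘ suc))

-- The formula of the theorem in terms of A = ⌈D/3⌉ and c = ⌊2D/3⌋. At `k = 0` it equals 1.
order : (A c k : ℕ) → ℕ
order A c k = (c + 1) ^ k + k * (∑[1≤ i ≤ A ] ((2 * i ∸ 1) ^ (k ∸ 1)))

2*1+n∸1 : ∀ h → 2 * suc h ∸ 1 ≡ suc (2 * h)
2*1+n∸1 h = +-suc h (h + 0)

-- Coding vectors by the summands of the formula

module Codes (A c k : ℕ) where

  -- `inj₁` codes the vectors in [A, A + c]^(k + 1). A triple `(i , h , p)` codes a vector whose
  -- i-th coordinate is `h`, the others being given by offsets `p` in a box of side 2h + 1.
  Code : Set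
  Code = Fin ((c + 1) ^ suc k) ⊎ (Fin (suc k) × (Σ[ h ∈ Fin A ] Fin ((2 * suc (toℕ h) ∸ 1) ^ k)))

  code : Fin (order A c (suc k)) ↔ Code
  code = (↔-refl ⊎-↔ ((↔-refl ×-↔ Fin-sum↔ A _) ↔-∘ Fin.*↔×)) ↔-∘ Fin.+↔⊎

  -- corner i h is the least corner of the box containing the remaining coordinates
  -- of the vectors whose i-th coordinate is h < A.
  module _ (corner : Fin (suc k) → ℕ → Fin k → ℕ) where

    decode : Code → Vector ℕ (suc k)
    decode (inj₁ q)           j = A + toℕ (finToFun {c + 1} {suc k} q j)
    decode (inj₂ (i , h , p)) =
      insertAt (λ j → corner i (toℕ h) j + toℕ (finToFun {2 * suc (toℕ h) ∸ 1} {k} p j)) i (toℕ h)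

    -- Any coordinate below `A` can serve as the index `i`: what matters is that `decode` recovers
    -- `x`, not that the code is unique.
    encode : (x : Vector ℕ (suc k)) → (∀ j → x j ≤ A + c) →
      (∀ i → x i < A → ∀ j → corner i (x i) j ≤ x (punchIn i j) ×
                             x (punchIn i j) ≤ corner i (x i) j + 2 * x i) →
      ∃[ t ] decode t ≗ x
    encode x x≤ box with Fin.all? (λ j → A ≤? x j)
    ... | yes A≤x = inj₁ (funToFin {suc k} {c + 1} q) , λ j → trans
            (cong (λ y → A + toℕ y) (Fin.finToFun-funToFin {suc k} {c + 1} q j))
            (trans (cong (A +_) (Fin.toℕ-fromℕ< (bound j))) (m+[n∸m]≡n (A≤x j)))
      where
      bound : ∀ j → x j ∸ A < c + 1
      bound j = subst (x j ∸ A <_) (+-comm 1 c) (s≤s (m≤n+o⇒m∸n≤o (x j) A (x≤ j)))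
      q : Fin (suc k) → Fin (c + 1)
      q j = fromℕ< (bound j)
    ... | no A≰x with Fin.¬∀⟶∃¬ (suc k) _ (λ j → A ≤? x j) A≰x
    ...   | i , A≰xᵢ = inj₂ (i , fromℕ< (≰⇒> A≰xᵢ) , funToFin {k} {2 * suc (toℕ h) ∸ 1} p) , eq
      where
      h = fromℕ< (≰⇒> A≰xᵢ)
      h≡ : toℕ h ≡ x i
      h≡ = Fin.toℕ-fromℕ< (≰⇒> A≰xᵢ)
      box′ : ∀ j → corner i (toℕ h) j ≤ x (punchIn i j) × x (punchIn i j) ≤ corner i (toℕ h) j + 2 * toℕ h
      box′ j = subst (λ h → corner i h j ≤ x (punchIn i j) × x (punchIn i j) ≤ corner i h j + 2 * h)
                 (sym h≡) (box i (≰⇒> A≰xᵢ) j)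
      bound : ∀ j → x (punchIn i j) ∸ corner i (toℕ h) j < 2 * suc (toℕ h) ∸ 1
      bound j = subst (x (punchIn i j) ∸ corner i (toℕ h) j <_) (sym (2*1+n∸1 (toℕ h)))
                  (s≤s (m≤n+o⇒m∸n≤o (x (punchIn i j)) (corner i (toℕ h) j) (proj₂ (box′ j))))
      p : Fin k → Fin (2 * suc (toℕ h) ∸ 1)
      p j = fromℕ< (bound j)
      rest : ∀ j → corner i (toℕ h) j + toℕ (finToFun {2 * suc (toℕ h) ∸ 1} {k} (funToFin p) j) ≡ x (punchIn i j)
      rest j = trans (cong (λ y → corner i (toℕ h) j + toℕ y) (Fin.finToFun-funToFin {k} {2 * suc (toℕ h) ∸ 1} p j))
               (trans (cong (corner i (toℕ h) j +_) (Fin.toℕ-fromℕ< (bound j)))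
                      (m+[n∸m]≡n (proj₁ (box′ j))))
      eq : decode (inj₂ (i , h , funToFin p)) ≗ x
      eq j with i Fin.≟ j
      ... | yes refl = trans (insertAt-lookup _ i _) h≡
      ... | no  i≢j  = subst (λ j → decode (inj₂ (i , h , funToFin p)) j ≡ x j) (Fin.punchIn-punchOut i≢j)
                         (trans (insertAt-punchIn _ i _ _) (rest (punchOut i≢j)))

-- Box counting for the upper bound

minimum : ∀ {n} {P : Fin n → Set} → (∀ u → Dec (P u)) → (f : Fin n → ℕ) →
  ∃[ m ] (∀ u → P u → m ≤ f u) × (∀ u → P u → ∃[ v ] P v × f v ≡ m)
minimum P? f with Fin.any? P?
-- Nothing satisfies `P`: 0 is a default value and both clauses are vacuous.
... | no ∄ = 0 , (λ _ _ → z≤n) , λ u p → contradiction (u , p) ∄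
... | yes (w , pw) with least (λ d → Fin.any? λ v → P? v ×-dec (f v ≟ d)) (f w) (w , pw , refl)
...   | m , attained , min = m , (λ u p → min (f u) (u , p , refl)) , λ _ _ → attained

-- Each corner is the coordinatewise minimum over all u with `x u i ≡ h`. Comparing u with a vertex
-- attaining the minimum, `spread` confines u to side 2h + 1, so coding is injective.
box-bound : ∀ {n} A c k (x : Fin n → Vector ℕ (suc k)) →
  (∀ u v → x u ≗ x v → u ≡ v) →
  (∀ u j → x u j ≤ A + c) →
  (∀ i u v → x u i ≡ x v i → ∀ j → x u j ≤ x v j + 2 * x u i) →
  n ≤ order A c (suc k)
box-bound {n} A c k x inj x≤ spread = Fin.injective⇒≤ {f = f} f-injective
  where
  open Codes A c k
  min : ∀ i h j → _
  min i h j = minimum {P = λ u → x u i ≡ h} (λ u → x u i ≟ h) (λ u → x u (punchIn i j))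
  corner : Fin (suc k) → ℕ → Fin k → ℕ
  corner i h j = proj₁ (min i h j)
  box : ∀ u i → x u i < A → ∀ j → corner i (x u i) j ≤ x u (punchIn i j) ×
                                  x u (punchIn i j) ≤ corner i (x u i) j + 2 * x u i
  box u i _ j with min i (x u i) j
  ... | m , lower , attained with attained u refl
  ...   | v , eq , refl = lower u refl , spread i u v (sym eq) (punchIn i j)
  enc : ∀ u → ∃[ t ] decode corner t ≗ x u
  enc u = encode corner (x u) (x≤ u) (box u)
  f : Fin n → Fin (order A c (suc k))
  f u = Inverse.from code (proj₁ (enc u))
  f-injective : ∀ {u v} → f u ≡ f v → u ≡ v
  f-injective {u} {v} eq = inj u v λ j → trans (sym (proj₂ (enc u) j))
    (trans (cong (λ t → decode corner t j) same) (proj₂ (enc v) j))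
    where
    same : proj₁ (enc u) ≡ proj₁ (enc v)
    same = trans (sym (Inverse.strictlyInverseˡ code _))
           (trans (cong (Inverse.to code) eq) (Inverse.strictlyInverseˡ code _))

-- Strict growth of the bound

∑-mono : ∀ n {f g : ℕ → ℕ} → (∀ i → f i ≤ g i) → sum (applyUpTo f n) ≤ sum (applyUpTo g n)
∑-mono zero    f≤g = z≤n
∑-mono (suc n) f≤g = +-mono-≤ (f≤g 0) (∑-mono n (f≤g ∘ suc))

-- The power of c + 1 ≥ 2 grows strictly, the other summand weakly.
order-strictMono : ∀ A c {k l} → 1 ≤ c → k < l → order A c k < order A c l
order-strictMono A c {k} {l} 1≤c k<l = +-mono-<-≤
  (^-monoʳ-< (c + 1) (+-monoˡ-≤ 1 1≤c) k<l)
  (*-mono-≤ (<⇒≤ k<l) (∑-mono A λ i → subst₂ (λ a b → a ^ (k ∸ 1) ≤ b ^ (l ∸ 1))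
     (sym (2*1+n∸1 i)) (sym (2*1+n∸1 i)) (^-monoʳ-≤ (suc (2 * i)) (∸-monoˡ-≤ 1 (<⇒≤ k<l)))))

-- Passing between subsets and indexed families

-- The inferred index type is `Fin ∣ S ∣`, so a resolving set supplies the coordinates of distance
-- vectors.
enumerate : ∀ {n} (S : Subset n) → ∃[ s ] (∀ x → x ∈ S → ∃[ i ] s i ≡ x)
enumerate {n} S = go S
  where
  go : ∀ {n} (S : Subset n) → Σ[ s ∈ (Fin ∣ S ∣ → Fin n) ] (∀ x → x ∈ S → ∃[ i ] s i ≡ x)
  go []            = (λ ()) , λ _ ()
  go (outside ∷ S) with go S
  ... | s , surj = suc ∘ s , λ { (suc x) (there x∈) → proj₁ (surj x x∈) , cong suc (proj₂ (surj x x∈)) }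
  go (inside ∷ S) with go S
  ... | s , surj = (λ { zero → zero ; (suc i) → suc (s i) }) ,
      λ { zero _ → zero , refl
        ; (suc x) (there x∈) → suc (proj₁ (surj x x∈)) , cong suc (proj₂ (surj x x∈)) }

∣p∪q∣≤∣p∣+∣q∣ : ∀ {n} (p q : Subset n) → ∣ p ∪ q ∣ ≤ ∣ p ∣ + ∣ q ∣
∣p∪q∣≤∣p∣+∣q∣ []            []            = z≤n
∣p∪q∣≤∣p∣+∣q∣ (outside ∷ p) (outside ∷ q) = ∣p∪q∣≤∣p∣+∣q∣ p q
∣p∪q∣≤∣p∣+∣q∣ (outside ∷ p) (inside  ∷ q) = subst (suc ∣ p ∪ q ∣ ≤_) (sym (+-suc ∣ p ∣ ∣ q ∣)) (s≤s (∣p∪q∣≤∣p∣+∣q∣ p q))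
∣p∪q∣≤∣p∣+∣q∣ (inside  ∷ p) (outside ∷ q) = s≤s (∣p∪q∣≤∣p∣+∣q∣ p q)
∣p∪q∣≤∣p∣+∣q∣ (inside  ∷ p) (inside  ∷ q) = s≤s (≤-trans (∣p∪q∣≤∣p∣+∣q∣ p q) (+-monoʳ-≤ ∣ p ∣ (n≤1+n ∣ q ∣)))

image : ∀ {k n} → (Fin k → Fin n) → Subset n
image {zero}  s = ∅
image {suc k} s = ⁅ s zero ⁆ ∪ image (s ∘ suc)

∈-image : ∀ {k n} (s : Fin k → Fin n) i → s i ∈ image s
∈-image s zero    = x∈p∪q⁺ (inj₁ (x∈⁅x⁆ (s zero)))
∈-image s (suc i) = x∈p∪q⁺ {p = ⁅ s zero ⁆} (inj₂ (∈-image (s ∘ suc) i))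

-- An inequality, as values may repeat. For the landmarks, equality follows from the lower bound on
-- the size of resolving sets.
∣image∣≤ : ∀ {k n} (s : Fin k → Fin n) → ∣ image s ∣ ≤ k
∣image∣≤ {zero}  {n} s = ≤-reflexive (∣⊥∣≡0 n)
∣image∣≤ {suc k} s = ≤-trans (∣p∪q∣≤∣p∣+∣q∣ ⁅ s zero ⁆ (image (s ∘ suc)))
  (+-mono-≤ (≤-reflexive (∣⁅x⁆∣≡1 (s zero))) (∣image∣≤ (s ∘ suc)))

-- Graph distance and the upper bound on the order

module Metric {n} {G : Graph n} (conn : Connected G) where
  open Graph G using (Adj) renaming (sym to Adj-sym)

  _++ʷ_ : ∀ {u v w k l} → Walk G u v k → Walk G v w l → Walk G u w (k + l)
  []       ++ʷ q = q
  (a ∷ p) ++ʷ q = a ∷ (p ++ʷ q)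

  reverseʷ : ∀ {u v k} → Walk G u v k → Walk G v u k
  reverseʷ [] = []
  reverseʷ {k = suc k} (a ∷ p) = subst (Walk G _ _) (+-comm k 1) (reverseʷ p ++ʷ (Adj-sym a ∷ []))

  dist-walk : ∀ u v → Walk G u v (dist conn u v)
  dist-walk u v = proj₁ (proj₂ (distance conn u v))

  dist-≤ : ∀ {u v k} → Walk G u v k → dist conn u v ≤ k
  dist-≤ {u} {v} p = proj₂ (proj₂ (distance conn u v)) _ p

  dist-triangle : ∀ u v w → dist conn u w ≤ dist conn u v + dist conn v w
  dist-triangle u v w = dist-≤ (dist-walk u v ++ʷ dist-walk v w)

  dist-sym≤ : ∀ u v → dist conn u v ≤ dist conn v u
  dist-sym≤ u v = dist-≤ (reverseʷ (dist-walk v u))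

-- Applies `box-bound` to the vectors of distances to `S`: resolving gives injectivity, and the
-- detour from u through `s i` to v gives `spread`.
order-bound : ∀ {n} {G : Graph n} (conn : Connected G) A c → (∀ u v → dist conn u v ≤ A + c) →
  (S : Subset n) → IsResolvingSet conn S → n ≤ order A c ∣ S ∣
order-bound {n} conn A c diam S resolving with ∣ S ∣ | enumerate S
-- An empty set resolves no pair, so there is at most one vertex, matching `order A c 0`.
... | zero | s , surj = small n refl
  where
  small : ∀ m → m ≡ n → m ≤ 1
  small 0 _ = z≤n
  small 1 _ = s≤s z≤n
  small (suc (suc m)) refl with resolving zero (suc zero) (λ ())
  ... | x , x∈S , _ with surj x x∈S
  ...   | () , _
... | suc k | s , surj = box-bound A c k (λ u j → dist conn u (s j)) injective (λ u j → diam u (s j)) spread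
  where
  open Metric conn
  injective : ∀ u v → (λ j → dist conn u (s j)) ≗ (λ j → dist conn v (s j)) → u ≡ v
  injective u v eq with u Fin.≟ v
  ... | yes u≡v = u≡v
  ... | no  u≢v with resolving u v u≢v
  ...   | x , x∈S , resolves with surj x x∈S
  ...     | i , refl = contradiction (eq i) resolves
  spread : ∀ i u v → dist conn u (s i) ≡ dist conn v (s i) →
    ∀ j → dist conn u (s j) ≤ dist conn v (s j) + 2 * dist conn u (s i)
  spread i u v eq j = begin
    dist conn u (s j)                              ≤⟨ dist-triangle u v (s j) ⟩
    dist conn u v + dist conn v (s j)              ≤⟨ +-monoˡ-≤ _ (dist-triangle u (s i) v) ⟩
    du + dist conn (s i) v + dist conn v (s j)     ≤⟨ +-monoˡ-≤ _ (+-monoʳ-≤ du (dist-sym≤ (s i) v)) ⟩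
    du + dist conn v (s i) + dist conn v (s j)     ≡⟨ cong (λ d → du + d + dist conn v (s j)) eq ⟨
    du + du + dist conn v (s j)                    ≡⟨ rearrange du (dist conn v (s j)) ⟩
    dist conn v (s j) + 2 * du                     ∎
    where
    open ≤-Reasoning
    du = dist conn u (s i)
    rearrange : ∀ a b → a + a + b ≡ b + 2 * a
    rearrange = solve-∀

-- Moving one step towards a target

-- A relation, so that closure proofs split on the directions of two coordinates. `down` names the
-- predecessor `s` of `a`, avoiding truncated subtraction.
data Toward (a b : ℕ) : ℕ → Set where
  up   : a < b → Toward a b (suc a)
  stay : a ≡ b → Toward a b a
  down : ∀ {s} → b ≤ s → a ≡ suc s → Toward a b s

toward : ∀ a b → ∃[ s ] Toward a b s
toward a b with <-cmp a b
... | tri< a<b _ _         = suc a , up a<b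
... | tri≈ _ a≡b _         = a , stay a≡b
... | tri> _ _ (s≤s b≤s)   = _ , down b≤s refl

module _ {a b s : ℕ} where

  toward-near : Toward a b s → s ≤ suc a × a ≤ suc s
  toward-near (up _)        = ≤-refl , m≤n+m a 2
  toward-near (stay _)      = n≤1+n a , n≤1+n a
  toward-near (down _ refl) = m≤n+m s 2 , ≤-refl

  toward-closer : ∀ k → a ≤ suc k + b → b ≤ suc k + a → Toward a b s → s ≤ k + b × b ≤ k + s
  toward-closer k p q (up a<b)        = m≤n⇒m≤o+n k a<b , subst (b ≤_) (sym (+-suc k a)) q
  toward-closer k p q (stay refl)     = m≤n+m a k , m≤n+m a k
  toward-closer k p q (down b≤s refl) = s≤s⁻¹ p , m≤n⇒m≤o+n k b≤s

  toward-≤ : ∀ {D} → a ≤ D → b ≤ D → Toward a b s → s ≤ D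
  toward-≤ p q (up a<b)      = ≤-trans a<b q
  toward-≤ p q (stay _)      = p
  toward-≤ p q (down _ refl) = <⇒≤ p

  module _ {B c d t : ℕ} where

    -- If the steps do not lower the sum, the bound at the start persists. Otherwise b ≤ s and d ≤
    -- t, and the bound at the target applies.
    toward-sum : B ≤ a + c → B ≤ b + d → Toward a b s → Toward c d t → B ≤ s + t
    toward-sum p q (up _)        (up _)        = ≤-trans p (+-mono-≤ (n≤1+n a) (n≤1+n c))
    toward-sum p q (up _)        (stay _)      = m≤n⇒m≤1+n p
    toward-sum p q (up _)        (down _ refl) = subst (B ≤_) (+-suc a t) p
    toward-sum p q (stay _)      (up _)        = ≤-trans p (+-monoʳ-≤ a (n≤1+n c))
    toward-sum p q (stay _)      (stay _)      = p
    toward-sum p q (stay refl)   (down d≤t _)  = ≤-trans q (+-monoʳ-≤ a d≤t)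
    toward-sum p q (down _ refl) (up _)        = subst (B ≤_) (sym (+-suc s c)) p
    toward-sum p q (down b≤s _)  (stay refl)   = ≤-trans q (+-monoˡ-≤ c b≤s)
    toward-sum p q (down b≤s _)  (down d≤t _)  = ≤-trans q (+-mono-≤ b≤s d≤t)

    -- If t - s does not exceed c - a, the bound at the start persists. Otherwise t ≤ d and b ≤ s,
    -- and the bound at the target applies.
    toward-difference : c ≤ a + B → d ≤ b + B → Toward a b s → Toward c d t → t ≤ s + B
    toward-difference p q (up _)        (up _)        = s≤s p
    toward-difference p q (up _)        (stay _)      = m≤n⇒m≤1+n p
    toward-difference p q (up _)        (down _ refl) = m≤n⇒m≤1+n (<⇒≤ p)
    toward-difference p q (stay refl)   (up c<d)      = ≤-trans c<d q
    toward-difference p q (stay _)      (stay _)      = p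
    toward-difference p q (stay _)      (down _ refl) = <⇒≤ p
    toward-difference p q (down b≤s _)  (up c<d)      = ≤-trans c<d (≤-trans q (+-monoˡ-≤ B b≤s))
    toward-difference p q (down b≤s _)  (stay refl)   = ≤-trans q (+-monoˡ-≤ B b≤s)
    toward-difference p q (down _ refl) (down _ refl) = s≤s⁻¹ p

-- Vertices of the extremal graph

-- The pairwise conditions say |x_j - B| ≤ x_i: `x` lies within Chebyshev distance x_i of the vector
-- with 0 at i and B elsewhere.
record Admissible (D B : ℕ) {k} (x : Vector ℕ k) : Set where
  field
    coord≤ : ∀ j → x j ≤ D
    sum≥   : ∀ {i j} → i ≢ j → B ≤ x i + x j
    diff≤  : ∀ {i j} → i ≢ j → x j ≤ x i + B
open Admissible

insertAt-view : ∀ {n} (xs : Vector ℕ n) i v j →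
  (j ≡ i × insertAt xs i v j ≡ v) ⊎ (i ≢ j × ∃[ l ] insertAt xs i v j ≡ xs l)
insertAt-view xs i v j with i Fin.≟ j
... | yes refl = inj₁ (refl , insertAt-lookup xs i v)
... | no  i≢j  = inj₂ (i≢j , punchOut i≢j ,
  trans (cong (insertAt xs i v) (sym (Fin.punchIn-punchOut i≢j))) (insertAt-punchIn xs i v (punchOut i≢j)))

-- `c≤B` and `B≤2A` make [A, A + c]^(k + 1) admissible; `2A≤1+B` prevents two coordinates below `A`;
-- `B+A≤1+D` keeps the boxes inside [0, D].
module ExtremalVectors (A B c k : ℕ)
  (c≤B : c ≤ B) (B≤2A : B ≤ A + A) (2A≤1+B : A + A ≤ suc B) (B+A≤1+D : B + A ≤ suc (A + c)) where

  -- All boxes are centred at B: [B - h, B + h]^k. By `h<B` nothing is truncated for h < A.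
  corner : Fin (suc k) → ℕ → Fin k → ℕ
  corner _ h _ = B ∸ h

  open Codes A c k

  point : Code → Vector ℕ (suc k)
  point = decode corner

  h+h′<B : ∀ {h h′} → h < A → h′ < A → h + h′ < B
  h+h′<B {h} {h′} h<A h′<A = s≤s⁻¹ (begin
    suc (suc (h + h′)) ≡⟨ cong suc (+-suc h h′) ⟨
    suc h + suc h′     ≤⟨ +-mono-≤ h<A h′<A ⟩
    A + A              ≤⟨ 2A≤1+B ⟩
    suc B              ∎)
    where open ≤-Reasoning

  h<B : ∀ {h} → h < A → h < B
  h<B {h} h<A = ≤-<-trans (m≤m+n h h) (h+h′<B h<A h<A)

  B+h≤D : ∀ {h} → h < A → B + h ≤ A + c
  B+h≤D {h} h<A = s≤s⁻¹ (begin
    suc (B + h) ≡⟨ +-suc B h ⟨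
    B + suc h   ≤⟨ +-monoʳ-≤ B h<A ⟩
    B + A       ≤⟨ B+A≤1+D ⟩
    suc (A + c) ∎)
    where open ≤-Reasoning

  Near : ℕ → ℕ → Set
  Near h y = B ≤ y + h × y ≤ B + h

  box-near : ∀ {h r} → h < A → r < 2 * suc h ∸ 1 → Near h (B ∸ h + r)
  box-near {h} {r} h<A r< = lower , upper
    where
    open ≤-Reasoning
    h≤B : h ≤ B
    h≤B = <⇒≤ (h<B h<A)
    r≤2h : r ≤ 2 * h
    r≤2h = s≤s⁻¹ (subst (r <_) (2*1+n∸1 h) r<)
    lower = begin
      B             ≡⟨ m∸n+n≡m h≤B ⟨
      B ∸ h + h     ≤⟨ +-monoˡ-≤ h (m≤m+n (B ∸ h) r) ⟩
      B ∸ h + r + h ∎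
    rearrange : ∀ a h → a + 2 * h ≡ a + h + h
    rearrange = solve-∀
    upper = begin
      B ∸ h + r     ≤⟨ +-monoʳ-≤ (B ∸ h) r≤2h ⟩
      B ∸ h + 2 * h ≡⟨ rearrange (B ∸ h) h ⟩
      B ∸ h + h + h ≡⟨ cong (_+ h) (m∸n+n≡m h≤B) ⟩
      B + h         ∎

  point-view : ∀ i (h : Fin A) p j → let y = point (inj₂ (i , h , p)) j in
    (j ≡ i × y ≡ toℕ h) ⊎ (i ≢ j × Near (toℕ h) y)
  point-view i h p j with insertAt-view (λ j → B ∸ toℕ h + toℕ (finToFun {2 * suc (toℕ h) ∸ 1} {k} p j)) i (toℕ h) j
  ... | inj₁ eq = inj₁ eq
  ... | inj₂ (i≢j , l , eq) = inj₂ (i≢j , subst (Near (toℕ h)) (sym eq)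
          (box-near (Fin.toℕ<n h) (Fin.toℕ<n (finToFun {2 * suc (toℕ h) ∸ 1} {k} p l))))

  point-admissible : ∀ t → Admissible (A + c) B (point t)
  point-admissible (inj₁ q) = record
    { coord≤ = upper
    ; sum≥   = λ {i} {j} _ → ≤-trans B≤2A (+-mono-≤ (lower i) (lower j))
    ; diff≤  = λ {i} {j} _ → ≤-trans (upper j) (+-mono-≤ (lower i) c≤B)
    }
    where
    lower : ∀ j → A ≤ point (inj₁ q) j
    lower j = m≤m+n A _
    upper : ∀ j → point (inj₁ q) j ≤ A + c
    upper j = +-monoʳ-≤ A (s≤s⁻¹ (subst (toℕ r <_) (+-comm c 1) (Fin.toℕ<n r)))
      where r = finToFun {c + 1} {suc k} q j
  point-admissible t@(inj₂ (i , h , p)) = record { coord≤ = upper ; sum≥ = sums ; diff≤ = diffs }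
    where
    h<A = Fin.toℕ<n h
    view = point-view i h p
    -- Since 2h < B, a coordinate at least B - h is at least h; a pair of near coordinates thus
    -- reduces to one near coordinate and h.
    h≤near : ∀ {y} → Near (toℕ h) y → toℕ h ≤ y
    h≤near {y} (lo , _) = +-cancelʳ-≤ (toℕ h) (toℕ h) y (≤-trans (<⇒≤ (h+h′<B h<A h<A)) lo)
    upper : ∀ j → point t j ≤ A + c
    upper j with point t j | view j
    ... | _ | inj₁ (_ , refl)     = ≤-trans (<⇒≤ h<A) (m≤m+n A c)
    ... | _ | inj₂ (_ , _ , y≤)   = ≤-trans y≤ (B+h≤D h<A)
    sums : ∀ {j l} → j ≢ l → B ≤ point t j + point t l
    sums {j} {l} j≢l with point t j | view j | point t l | view l
    ... | _ | inj₁ (refl , _)      | _ | inj₁ (refl , _)    = contradiction refl j≢l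
    ... | _ | inj₁ (_ , refl)      | y | inj₂ (_ , B≤ , _)  = subst (B ≤_) (+-comm y (toℕ h)) B≤
    ... | _ | inj₂ (_ , B≤ , _)    | _ | inj₁ (_ , refl)    = B≤
    ... | y | inj₂ (_ , B≤ , _)    | z | inj₂ (_ , near)    = ≤-trans B≤ (+-monoʳ-≤ y (h≤near near))
    diffs : ∀ {j l} → j ≢ l → point t l ≤ point t j + B
    diffs {j} {l} j≢l with point t j | view j | point t l | view l
    ... | _ | inj₁ (refl , _)      | _ | inj₁ (refl , _)    = contradiction refl j≢l
    ... | _ | inj₁ (_ , refl)      | y | inj₂ (_ , _ , y≤)  = subst (y ≤_) (+-comm B (toℕ h)) y≤
    ... | y | inj₂ _               | _ | inj₁ (_ , refl)    = ≤-trans (<⇒≤ (h<B h<A)) (m≤n+m B y)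
    ... | y | inj₂ (_ , near)      | z | inj₂ (_ , _ , z≤)  =
      ≤-trans z≤ (subst (_≤ y + B) (+-comm (toℕ h) B) (+-monoˡ-≤ B (h≤near near)))

  -- A coordinate below `A` separates the two summands. Two codes with different indices i would
  -- give B ≤ h + h′, against `h+h′<B`.
  point-injective : ∀ t u → point t ≗ point u → t ≡ u
  point-injective (inj₁ q) (inj₁ r) eq = cong inj₁ (finToFun-injective {c + 1} {suc k}
    λ j → Fin.toℕ-injective (+-cancelˡ-≡ A _ _ (eq j)))
  point-injective (inj₁ q) (inj₂ (i , h , p)) eq =
    contradiction (≤-trans (Fin.toℕ<n h) (m≤m+n A _)) (<-irrefl (sym (trans (eq i) (insertAt-lookup _ i _))))
  point-injective (inj₂ (i , h , p)) (inj₁ q) eq =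
    contradiction (≤-trans (Fin.toℕ<n h) (m≤m+n A _)) (<-irrefl (trans (sym (insertAt-lookup _ i _)) (eq i)))
  point-injective (inj₂ (i , h , p)) (inj₂ (i′ , h′ , p′)) eq with point-view i′ h′ p′ i
  ... | inj₂ (_ , B≤ , _) = contradiction (h+h′<B (Fin.toℕ<n h) (Fin.toℕ<n h′))
          (≤⇒≯ (subst (λ y → B ≤ y + toℕ h′) (trans (sym (eq i)) (insertAt-lookup _ i _)) B≤))
  ... | inj₁ (refl , y≡h′) with Fin.toℕ-injective (trans (sym (insertAt-lookup _ i (toℕ h))) (trans (eq i) y≡h′))
  ...   | refl = cong (λ p → inj₂ (i , h , p)) (finToFun-injective {2 * suc (toℕ h) ∸ 1} {k} λ j →
          Fin.toℕ-injective (+-cancelˡ-≡ (B ∸ toℕ h) _ _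
            (trans (sym (insertAt-punchIn _ i _ j)) (trans (eq (punchIn i j)) (insertAt-punchIn _ i _ j)))))

  N : ℕ
  N = order A c (suc k)

  -- Vertices are indices of codes, so the order is right by construction; `coords-admissible` and
  -- `vertex` identify them with the admissible vectors.
  coords : Fin N → Vector ℕ (suc k)
  coords u = point (Inverse.to code u)

  coords-injective : ∀ {u v} → coords u ≗ coords v → u ≡ v
  coords-injective {u} {v} eq = trans (sym (Inverse.strictlyInverseʳ code u))
    (trans (cong (Inverse.from code) (point-injective (Inverse.to code u) (Inverse.to code v) eq)) (Inverse.strictlyInverseʳ code v))

  coords-admissible : ∀ u → Admissible (A + c) B (coords u)
  coords-admissible u = point-admissible (Inverse.to code u)

  -- When x_i < A, the pairwise conditions are exactly membership of the other coordinates in the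
  -- box with corner B - x_i.
  vertex : ∀ x → Admissible (A + c) B x → ∃[ u ] coords u ≗ x
  vertex x adm with encode corner x (coord≤ adm) box
    where
    box : ∀ i → x i < A → ∀ j → B ∸ x i ≤ x (punchIn i j) × x (punchIn i j) ≤ B ∸ x i + 2 * x i
    box i xᵢ<A j = m≤n+o⇒m∸n≤o B (x i) (sum≥ adm i≢) , (begin
      x (punchIn i j)       ≤⟨ diff≤ adm i≢ ⟩
      x i + B               ≡⟨ cong (x i +_) (m∸n+n≡m (<⇒≤ (h<B xᵢ<A))) ⟨
      x i + (B ∸ x i + x i) ≡⟨ rearrange (x i) (B ∸ x i) ⟩
      B ∸ x i + 2 * x i     ∎)
      where
      open ≤-Reasoning
      i≢ : i ≢ punchIn i j
      i≢ = Fin.punchInᵢ≢i i j ∘ sym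
      rearrange : ∀ a b → a + (b + a) ≡ b + 2 * a
      rearrange = solve-∀
  ... | t , eq = Inverse.from code t , λ j →
        trans (cong (λ t → point t j) (Inverse.strictlyInverseˡ code t)) (eq j)

-- Distance, landmarks and diameter in the extremal graph

module Chebyshev {N k} (D B : ℕ) (B≤D : B ≤ D)
  (coords : Fin N → Vector ℕ (suc k))
  (coords-injective : ∀ {u v} → coords u ≗ coords v → u ≡ v)
  (coords-admissible : ∀ u → Admissible D B (coords u))
  (vertex : ∀ x → Admissible D B x → ∃[ u ] coords u ≗ x)
  where

  Close : ℕ → Fin N → Fin N → Set
  Close d u v = ∀ j → coords u j ≤ d + coords v j × coords v j ≤ d + coords u j

  graph : Graph N
  graph = record
    { Adj    = λ u v → u ≢ v × Close 1 u v
    ; adj?   = λ u v → ¬? (u Fin.≟ v) ×-dec Fin.all? λ j → (_ ≤? _) ×-dec (_ ≤? _)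
    ; sym    = λ (u≢v , close) → (u≢v ∘ sym) , λ j → proj₂ (close j) , proj₁ (close j)
    ; irrefl = λ u≡v (u≢v , _) → u≢v u≡v
    }

  -- An edge changes each coordinate by at most 1; this bounds distances from below.
  walk-lipschitz : ∀ {u v d} → Walk graph u v d → Close d u v
  walk-lipschitz [] j = ≤-refl , ≤-refl
  walk-lipschitz {u} {v} {suc d} (_∷_ {v = w} (_ , close) p) j =
    ≤-trans (proj₁ (close j)) (s≤s (proj₁ (walk-lipschitz p j))) ,
    ≤-trans (proj₂ (walk-lipschitz p j)) (subst (d + coords w j ≤_) (+-suc d _) (+-monoʳ-≤ d (proj₂ (close j))))

  one-step : ∀ u v → ∃[ w ] ∀ j → Toward (coords u j) (coords v j) (coords w j)
  one-step u v = proj₁ w , λ j → subst (Toward _ _) (sym (proj₂ w j)) (move j)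
    where
    move : ∀ j → Toward (coords u j) (coords v j) (proj₁ (toward (coords u j) (coords v j)))
    move j = proj₂ (toward (coords u j) (coords v j))
    U = coords-admissible u
    V = coords-admissible v
    w = vertex (λ j → proj₁ (toward (coords u j) (coords v j))) record
      { coord≤ = λ j → toward-≤ (coord≤ U j) (coord≤ V j) (move j)
      ; sum≥   = λ {i} {j} i≢j → toward-sum (sum≥ U i≢j) (sum≥ V i≢j) (move i) (move j)
      ; diff≤  = λ {i} {j} i≢j → toward-difference (diff≤ U i≢j) (diff≤ V i≢j) (move i) (move j)
      }

  geodesic : ∀ d u v → Close d u v → ∃[ l ] l ≤ d × Walk graph u v l
  geodesic zero    u v close with coords-injective {u} {v} (λ j → ≤-antisym (proj₁ (close j)) (proj₂ (close j)))
  ... | refl = 0 , z≤n , []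
  geodesic (suc d) u v close with one-step u v
  ... | w , move with geodesic d w v (λ j → toward-closer d (proj₁ (close j)) (proj₂ (close j)) (move j)) | u Fin.≟ w
  -- The step did not move, and adjacency excludes loops, so no edge is added; hence a length at
  -- most `d` rather than equal to it.
  ...   | l , l≤d , p | yes refl = l , m≤n⇒m≤1+n l≤d , p
  ...   | l , l≤d , p | no  u≢w  = suc l , s≤s l≤d , (u≢w , swap ∘ toward-near ∘ move) ∷ p

  close-diameter : ∀ u v → Close D u v
  close-diameter u v j = ≤-trans (coord≤ (coords-admissible u) j) (m≤m+n _ _) ,
                  ≤-trans (coord≤ (coords-admissible v) j) (m≤m+n _ _)

  connected : Connected graph
  connected u v with geodesic D u v (close-diameter u v)
  ... | l , _ , p = l , p

  open Metric connected

  dist-close : ∀ {d} u v → Close d u v → dist connected u v ≤ d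
  dist-close {d} u v close with geodesic d u v close
  ... | l , l≤d , p = ≤-trans (dist-≤ p) l≤d

  landmark-coords : Fin (suc k) → Vector ℕ (suc k)
  landmark-coords i = insertAt (λ _ → B) i 0

  landmark-admissible : ∀ i → Admissible D B (landmark-coords i)
  landmark-admissible i = record { coord≤ = upper ; sum≥ = sums ; diff≤ = diffs }
    where
    view = insertAt-view (λ (_ : Fin k) → B) i 0
    upper : ∀ j → landmark-coords i j ≤ D
    upper j with landmark-coords i j | view j
    ... | _ | inj₁ (_ , refl)     = z≤n
    ... | _ | inj₂ (_ , _ , refl) = B≤D
    sums : ∀ {j l} → j ≢ l → B ≤ landmark-coords i j + landmark-coords i l
    sums {j} {l} j≢l with landmark-coords i j | view j | landmark-coords i l | view l
    ... | _ | inj₁ (refl , _)     | _ | inj₁ (refl , _)     = contradiction refl j≢l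
    ... | _ | inj₂ (_ , _ , refl) | z | _                   = m≤m+n B z
    ... | y | _                   | _ | inj₂ (_ , _ , refl) = m≤n+m B y
    diffs : ∀ {j l} → j ≢ l → landmark-coords i l ≤ landmark-coords i j + B
    diffs {j} {l} _ with landmark-coords i j | landmark-coords i l | view l
    ... | y | _ | inj₁ (_ , refl)     = z≤n
    ... | y | _ | inj₂ (_ , _ , refl) = m≤n+m B y

  landmark : Fin (suc k) → Fin N
  landmark i = proj₁ (vertex (landmark-coords i) (landmark-admissible i))

  landmark-coord : ∀ i → coords (landmark i) ≗ landmark-coords i
  landmark-coord i = proj₂ (vertex (landmark-coords i) (landmark-admissible i))

  landmark-self : ∀ i → coords (landmark i) i ≡ 0
  landmark-self i = trans (landmark-coord i i) (insertAt-lookup _ i 0)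

  -- Admissibility puts u within x_i of the landmark in every coordinate. Conversely, the i-th
  -- coordinate must fall from x_i to 0 along any walk.
  dist-landmark : ∀ u i → dist connected u (landmark i) ≡ coords u i
  dist-landmark u i = ≤-antisym (dist-close u (landmark i) close) (begin
    coords u i                                 ≤⟨ proj₁ (walk-lipschitz (dist-walk u (landmark i)) i) ⟩
    dist connected u (landmark i) + coords (landmark i) i ≡⟨ cong (dist connected u (landmark i) +_) (landmark-self i) ⟩
    dist connected u (landmark i) + 0          ≡⟨ +-identityʳ _ ⟩
    dist connected u (landmark i)              ∎)
    where
    open ≤-Reasoning
    close : Close (coords u i) u (landmark i)
    close j rewrite landmark-coord i j with landmark-coords i j | insertAt-view (λ (_ : Fin k) → B) i 0 j
    ... | _ | inj₁ (refl , refl)      = m≤m+n _ 0 , z≤n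
    ... | _ | inj₂ (i≢j , _ , refl) = diff≤ (coords-admissible u) i≢j , sum≥ (coords-admissible u) i≢j

  landmarks-resolve : IsResolvingSet connected (image landmark)
  landmarks-resolve u v u≢v with Fin.all? (λ i → coords u i ≟ coords v i)
  ... | yes eq = contradiction (coords-injective eq) u≢v
  ... | no neq with Fin.¬∀⟶∃¬ (suc k) _ (λ i → coords u i ≟ coords v i) neq
  ...   | i , differ = landmark i , ∈-image landmark i ,
          λ eq → differ (trans (sym (dist-landmark u i)) (trans eq (dist-landmark v i)))

  diam≤ : ∀ u v → dist connected u v ≤ D
  diam≤ u v = dist-close u v (close-diameter u v)

  diameter : HasDiameter connected D
  diameter = (far , landmark zero , trans (dist-landmark far zero) (proj₂ top zero)) ,
             λ { _ (u , v , refl) → diam≤ u v }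
    where
    -- The constant vector D is at distance D from every landmark.
    top = vertex (λ _ → D) record
      { coord≤ = λ _ → ≤-refl
      ; sum≥   = λ _ → m≤n⇒m≤n+o D B≤D
      ; diff≤  = λ _ → m≤m+n D B
      }
    far = proj₁ top

-- Arithmetic of thirds and conclusion

-- Here `q` stands for ⌊D/3⌋, and B is `A + q`.
extremal : ∀ A c q k → 1 ≤ A → 1 ≤ c → q ≤ A → A ≤ suc q → c ≤ A + q → A + q ≤ suc c →
  Σ[ G ∈ Graph (order A c (suc k)) ] Σ[ conn ∈ Connected G ]
    (HasDiameter conn (A + c) × HasMetricDimension conn (suc k))
extremal A c q k 1≤A 1≤c q≤A A≤1+q c≤A+q A+q≤1+c =
  graph , connected , diameter ,
  (image landmark , landmarks-resolve ,
   ≤-antisym (∣image∣≤ landmark) (resolving⇒≥ (image landmark) landmarks-resolve)) ,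
  λ { _ (S , resolving , refl) → resolving⇒≥ S resolving }
  where
  2A≤1+B : A + A ≤ suc (A + q)
  2A≤1+B = subst (A + A ≤_) (+-suc A q) (+-monoʳ-≤ A A≤1+q)
  B+A≤1+D : A + q + A ≤ suc (A + c)
  B+A≤1+D = subst₂ _≤_ (+-comm A (A + q)) (+-suc A c) (+-monoʳ-≤ A A+q≤1+c)
  open ExtremalVectors A (A + q) c k c≤A+q (+-monoʳ-≤ A q≤A) 2A≤1+B B+A≤1+D
  -- B ≤ D is the box bound at h = 0, available as 1 ≤ A.
  open Chebyshev (A + c) (A + q) (subst (_≤ A + c) (+-identityʳ (A + q)) (B+h≤D 1≤A))
    coords coords-injective coords-admissible vertex
  resolving⇒≥ : ∀ S → IsResolvingSet connected S → suc k ≤ ∣ S ∣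
  resolving⇒≥ S resolving = ≮⇒≥ λ ∣S∣<k →
    <⇒≱ (order-strictMono A c 1≤c ∣S∣<k) (order-bound connected A c diam≤ S resolving)

Thirds : (D A c : ℕ) → Set
Thirds D A c = A + c ≡ D × 1 ≤ A × 1 ≤ c × ∃[ q ] q ≤ A × A ≤ suc q × c ≤ A + q × A + q ≤ suc c

thirds : ∀ D → 2 ≤ D → Thirds D ⌈ D / 3 ⌉ ((2 * D) / 3)
thirds D 2≤D = split (D % 3) (D / 3) (m%n<n D 3) (m≡m%n+[m/n]*n D 3)
  where
  quotient : ∀ {m} r q → m ≡ r + q * 3 → m / 3 ≡ r / 3 + q
  quotient r q refl = trans (+-distrib-/-∣ʳ r (n∣m*n q)) (cong (r / 3 +_) (m*n/n≡m q 3))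
  plus-2 : ∀ r q → r + q * 3 + 2 ≡ r + 2 + q * 3
  plus-2 = solve-∀
  times-2 : ∀ r q → 2 * (r + q * 3) ≡ 2 * r + 2 * q * 3
  times-2 = solve-∀
  double : ∀ q → 2 * q ≡ q + q
  double = solve-∀
  reduce : ∀ r q → D ≡ r + q * 3 → Thirds D ((r + 2) / 3 + q) ((2 * r) / 3 + 2 * q) →
    Thirds D ⌈ D / 3 ⌉ ((2 * D) / 3)
  reduce r q eq = subst₂ (Thirds D)
    (sym (quotient (r + 2) q (trans (cong (_+ 2) eq) (plus-2 r q))))
    (sym (quotient (2 * r) (2 * q) (trans (cong (2 *_) eq) (times-2 r q))))
  split : ∀ r q → r < 3 → D ≡ r + q * 3 → Thirds D ⌈ D / 3 ⌉ ((2 * D) / 3)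
  -- D would be 0 or 1, where ⌊2D/3⌋ = 0 violates 1 ≤ c.
  split 0 zero    _ eq = contradiction (subst (2 ≤_) eq 2≤D) λ ()
  split 1 zero    _ eq = contradiction (subst (2 ≤_) eq 2≤D) λ { (s≤s ()) }
  split 0 q@(suc _) _ eq = reduce 0 q eq
    (trans (sum₀ q) (sym eq) , s≤s z≤n , s≤s z≤n , q ,
     ≤-refl , n≤1+n q , ≤-reflexive (double q) , m≤n⇒m≤1+n (≤-reflexive (sym (double q))))
    where
    sum₀ : ∀ q → q + 2 * q ≡ q * 3
    sum₀ = solve-∀
  split 1 q@(suc _) _ eq = reduce 1 q eq
    (trans (sum₁ q) (sym eq) , s≤s z≤n , s≤s z≤n , q ,
     n≤1+n q , ≤-refl , m≤n⇒m≤1+n (≤-reflexive (double q)) , s≤s (≤-reflexive (sym (double q))))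
    where
    sum₁ : ∀ q → suc q + 2 * q ≡ suc (q * 3)
    sum₁ = solve-∀
  split 2 q _ eq = reduce 2 q eq
    (trans (sum₂ q) (sym eq) , s≤s z≤n , s≤s z≤n , q ,
     n≤1+n q , ≤-refl , s≤s (≤-reflexive (double q)) , m≤n⇒m≤1+n (s≤s (≤-reflexive (sym (double q)))))
    where
    sum₂ : ∀ q → suc q + suc (2 * q) ≡ 2 + q * 3
    sum₂ = solve-∀
  split (suc (suc (suc _))) _ (s≤s (s≤s (s≤s ()))) _

theorem3p1 : ∀ (D β : ℕ) → 2 ≤ D → 1 ≤ β →
    IsGreatest
    (λ n → Σ[ G ∈ Graph n ] Σ[ conn ∈ Connected G ]
    (HasDiameter conn D × HasMetricDimension conn β))
    (((2 * D) / 3 + 1) ^ β + β * (∑[1≤ i ≤ ⌈ D / 3 ⌉ ] ((2 * i ∸ 1) ^ (β ∸ 1))))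
-- Abstracting both quotients makes `A` and `c` variables, so D can be replaced by `A + c`.
theorem3p1 D (suc k) 2≤D _ with ⌈ D / 3 ⌉ | (2 * D) / 3 | thirds D 2≤D
... | A | c | refl , 1≤A , 1≤c , q , q≤A , A≤1+q , c≤A+q , A+q≤1+c =
  extremal A c q k 1≤A 1≤c q≤A A≤1+q c≤A+q A+q≤1+c ,
  λ { _ (G , conn , (_ , diam≤) , (S , resolving , ∣S∣≡β) , _) →
      subst (λ β → _ ≤ order A c β) ∣S∣≡β
        (order-bound conn A c (λ u v → diam≤ _ (u , v , refl)) S resolving) }
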